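{- Let $P, Q$ and $R$ be three finite connected posets. Then $$\langle \delta(P), Q\otimes R\rangle=\frac{1}{|\min(P)|}\langle P, Q\triangleright R\rangle.$$
   Context: $\mathbb{U}$ is the linear species of finite connected posets. For finite connected posets $P$ on $X_1$ and $Q$ on $X_2$ and $v\in X_2$, $P\searrow_v Q$ is the poset on $X_1\sqcup X_2$ obtained from the Hasse graphs of $P$ and $Q$ by adding an oriented edge from $v$ (in the Hasse graph of $Q$) to every minimal vertex of the Hasse graph of $P$. The product $\triangleright$ is $P\triangleright Q=\sum_{v\in \min(Q)}P\searrow_v Q$, where $\min(Q)$ is the set of minimal elements. For a subset $I$ of a finite connected poset $P$, let $I_-=\{x\notin I : \exists y\in I,\ x\le_P y\}$; write $I\circledcirc P$ when $I_-$ is a singleton contained in $\min(P)$ and $I$ is a connected component of the set $\{x\in P : I_-<_P x\}$. The coproduct is $\delta(P)=\frac{1}{|\min(P)|}\sum_{I\circledcirc P} I\otimes P\setminus I$ (with induced orders). For a poset $P$, $\mathrm{Aut}(P)$ is its automorphism group and $\sigma(P)=|\mathrm{Aut}(P)|$; the pairing is $\langle Q,R\rangle=\sigma(Q)$ if $Q\cong R$ and $0$ otherwise (i.e., the number of isomorphisms from $Q$ to $R$), extended bilinearly, with $\langle Q\otimes R, Q'\otimes R'\rangle=\langle Q,Q'\rangle\langle R,R'\rangle$. -}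

module Defs where

open import Data.Nat using (ℕ; zero; suc; _+_; _≤_)
import Data.Nat as ℕ
open import Data.Bool using (Bool; true; false; not; _∧_; _∨_; if_then_else_)
import Data.Bool as 𝔹
open import Data.Fin using (Fin; zero; suc; splitAt)
import Data.Fin as F
open import Data.List using (List; []; _∷_; map; concatMap; allFin)
open import Data.Bool.ListAction using (all; any)
open import Data.Nat.ListAction using (sum)
open import Data.Sum using (_⊎_; inj₁; inj₂)
open import Data.Product using (_×_)
open import Data.Integer using (+_)
open import Data.Rational using (ℚ; _/_; 0ℚ)
import Data.Rational as ℚ
open import Relation.Nullary.Decidable using (⌊_⌋)
open import Relation.Binary.PropositionalEquality using (_≡_)

-- Finite posets.  A poset on an n-element set is modelled on Fin n with a
-- Bool-valued order relation (so that counting is computable).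

record RawPoset : Set where
  field
    size : ℕ
    le   : Fin size → Fin size → Bool
open RawPoset public

record FinPoset : Set where
  field
    raw     : RawPoset
    reflexive     : ∀ x → le raw x x ≡ true
    antisymmetric : ∀ x y → le raw x y ≡ true → le raw y x ≡ true → x ≡ y
    transitive    : ∀ x y z → le raw x y ≡ true → le raw y z ≡ true → le raw x z ≡ true
open FinPoset public

Comparable : (P : RawPoset) → Fin (size P) → Fin (size P) → Set
Comparable P x y = (le P x y ≡ true) ⊎ (le P y x ≡ true)

data Zigzag (P : RawPoset) : Fin (size P) → Fin (size P) → Set where
  here : ∀ {x} → Zigzag P x x
  step : ∀ {x y z} → Comparable P x y → Zigzag P y z → Zigzag P x z

Connected : FinPoset → Set
Connected P = (1 ≤ size (raw P)) × (∀ x y → Zigzag (raw P) x y)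

allF : ∀ n → (Fin n → Bool) → Bool
allF n p = all p (allFin n)

anyF : ∀ n → (Fin n → Bool) → Bool
anyF n p = any p (allFin n)

_=ᶠ_ : ∀ {n} → Fin n → Fin n → Bool
x =ᶠ y = ⌊ x F.≟ y ⌋

_=ᵇ_ : Bool → Bool → Bool
a =ᵇ b = ⌊ a 𝔹.≟ b ⌋

countB : ∀ {A : Set} → (A → Bool) → List A → ℕ
countB p xs = sum (map (λ a → if p a then 1 else 0) xs)

funsOver : ∀ {B : Set} → List B → (m : ℕ) → List (Fin m → B)
funsOver bs zero = (λ ()) ∷ []
funsOver {B} bs (suc m) = concatMap (λ f → map (λ b → cons b f) bs) (funsOver bs m)
  where
  cons : B → (Fin m → B) → Fin (suc m) → B
  cons b f zero = b
  cons b f (suc i) = f i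

subsets : (n : ℕ) → List (Fin n → Bool)
subsets n = funsOver (true ∷ false ∷ []) n

isMin : (P : RawPoset) → Fin (size P) → Bool
isMin P x = allF (size P) (λ y → not (le P y x) ∨ (y =ᶠ x))

|min| : RawPoset → ℕ
|min| P = countB (isMin P) (allFin (size P))

-- Pairing  ⟨ P|S , Q ⟩ : the number of isomorphisms between the subposet of
-- P induced on the subset S and Q, counted as the number of maps
-- f : Fin (size Q) → Fin (size P) which are injective, have image exactly S,
-- and satisfy  a ≤_Q b  iff  f a ≤_P f b.

isIsoOnto : (Q P : RawPoset) (S : Fin (size P) → Bool) → (Fin (size Q) → Fin (size P)) → Bool
isIsoOnto Q P S f =
  allF (size Q) (λ a → allF (size Q) (λ b → not (f a =ᶠ f b) ∨ (a =ᶠ b)))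
  ∧ allF (size P) (λ x → S x =ᵇ anyF (size Q) (λ a → f a =ᶠ x))
  ∧ allF (size Q) (λ a → allF (size Q) (λ b → le Q a b =ᵇ le P (f a) (f b)))

pairSub : (P : RawPoset) (S : Fin (size P) → Bool) (Q : RawPoset) → ℕ
pairSub P S Q = countB (isIsoOnto Q P S) (funsOver (allFin (size P)) (size Q))

-- ⟨ P , Q ⟩ = number of isomorphisms (= σ(Q) if P ≅ Q, else 0)
pair : RawPoset → RawPoset → ℕ
pair P Q = pairSub P (λ _ → true) Q

module _ (P : RawPoset) where
  private
    n = size P
    comp : Fin n → Fin n → Bool
    comp x y = le P x y ∨ le P y x

  reach : (Fin n → Bool) → Fin n → Fin n → Bool
  reach S x = iter n (λ y → S y ∧ (y =ᶠ x))
    where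
    stepR : (Fin n → Bool) → Fin n → Bool
    stepR T y = T y ∨ (S y ∧ anyF n (λ z → T z ∧ comp z y))
    iter : ℕ → (Fin n → Bool) → Fin n → Bool
    iter zero T = T
    iter (suc k) T = iter k (stepR T)

  isComponent : (S I : Fin n → Bool) → Bool
  isComponent S I =
    allF n (λ x → not (I x) ∨ S x)
    ∧ anyF n (λ x → I x ∧ allF n (λ y → I y =ᵇ reach S x y))

  lowerSet⁻ : (Fin n → Bool) → Fin n → Bool
  lowerSet⁻ I x = not (I x) ∧ anyF n (λ y → I y ∧ le P x y)

  circ : (Fin n → Bool) → Bool
  circ I = anyF n (λ u →
      isMin P u
    ∧ allF n (λ x → lowerSet⁻ I x =ᵇ (x =ᶠ u))
    ∧ isComponent (λ x → le P u x ∧ not (u =ᶠ x)) I)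

ℕ→ℚ : ℕ → ℚ
ℕ→ℚ k = + k / 1

recip : ℕ → ℚ
recip zero = 0ℚ
recip (suc k) = + 1 / suc k

-- ⟨ δ(P) , Q ⊗ R ⟩ where
--   δ(P) = 1/|min P| · Σ_{I ⊚ P} I ⊗ (P ∖ I)

deltaPair : (P Q R : RawPoset) → ℚ
deltaPair P Q R =
  recip (|min| P) ℚ.*
  ℕ→ℚ (sum (map (λ I → if circ P I
                          then pairSub P I Q ℕ.* pairSub P (λ x → not (I x)) R
                          else 0)
                (subsets (size P))))

-- Q ↘_v R : poset on Fin (size Q + size R) (Q on the first block, R on the
-- second), whose order is generated by those of Q and R and the relations
-- v < q for q ∈ min(Q);  so r ≤ q  iff  r ≤_R v.

graft : (Q R : RawPoset) → Fin (size R) → RawPoset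
graft Q R v = record { size = size Q + size R ; le = λ a b → go (splitAt (size Q) a) (splitAt (size Q) b) }
  where
  go : Fin (size Q) ⊎ Fin (size R) → Fin (size Q) ⊎ Fin (size R) → Bool
  go (inj₁ x) (inj₁ y) = le Q x y
  go (inj₂ x) (inj₂ y) = le R x y
  go (inj₂ x) (inj₁ y) = le R x v
  go (inj₁ x) (inj₂ y) = false

-- Q ▷ R = Σ_{v ∈ min R} Q ↘_v R, as a formal sum (list of terms)
triangle : (Q R : RawPoset) → List RawPoset
triangle Q R = concatMap (λ v → if isMin R v then graft Q R v ∷ [] else []) (allFin (size R))

pairSum : RawPoset → List RawPoset → ℕ
pairSum P Ts = sum (map (pair P) Ts)

{-# OPTIONS --safe #-}

-- Both sides count pairs of maps f : Q → P, g : R → P, with multiplicity.  On the left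
-- (f , g) is counted once for every subset I ⊚ P such that f is an isomorphism onto I and g
-- one onto P ∖ I; such an I can only be the image of f.  On the right it is counted once for
-- every v ∈ min R such that f and g glue to an isomorphism Q ↘_v R → P; such a v is unique
-- because g v is the only element outside the image of f lying below it.  The two conditions
-- are equivalent: I₋ = {g v}, and Q being connected corresponds to I being a full connected
-- component of the elements strictly above g v.
module Submission where

open import Defs
open import Data.Bool using (Bool; true; false; not; _∧_; _∨_; if_then_else_)
import Data.Bool as 𝔹
open import Data.Bool.ListAction using (all; any)
open import Data.Bool.Properties using (¬-not)
open import Data.Fin using (Fin; zero; suc; splitAt; _↑ˡ_; _↑ʳ_; join)
import Data.Fin as F
open import Data.Fin.Properties
  using (splitAt-↑ˡ; splitAt-↑ʳ; join-splitAt; ↑ˡ-injective; ↑ʳ-injective; suc-injective; all?; any?; ¬∀⟶∃¬)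
open import Data.Fin.Subset using (Subset; ∣_∣; _∈_)
open import Data.Fin.Subset.Properties using (∣p∣≤n; p⊂q⇒∣p∣<∣q∣)
open import Data.List using (List; []; _∷_; _++_; map; concatMap; tabulate; allFin)
open import Data.List.Membership.Propositional.Properties using (∈-allFin)
open import Data.List.Properties using (map-cong; map-∘; map-++; map-tabulate)
open import Data.List.Relation.Unary.All using (All; []; _∷_)
import Data.List.Relation.Unary.All as All
open import Data.List.Relation.Unary.Any using (Any; here; there)
import Data.List.Relation.Unary.Any as Any
open import Data.Nat using (ℕ; zero; suc; _+_)
import Data.Nat as ℕ
open import Data.Nat.ListAction using (sum)
open import Data.Nat.ListAction.Properties using (sum-++)
import Data.Nat.Properties as ℕ
open import Data.Nat.Solver using (module +-*-Solver)
open import Data.Product using (∃; _×_; _,_; proj₁; proj₂)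
open import Data.Rational using (_*_)
import Data.Sum as Sum
open import Data.Sum using (_⊎_; inj₁; inj₂; [_,_]′)
open import Data.Sum.Properties using ([,]-map)
import Data.Vec as Vec
open import Data.Vec.Properties using (lookup∘tabulate; lookup⇒[]=; []=⇒lookup)
open import Function using (_∘_; id; _⇔_; mk⇔; Equivalence)
open import Relation.Binary.PropositionalEquality
  using (_≡_; _≢_; _≗_; refl; sym; trans; cong; cong₂; subst; module ≡-Reasoning)
open import Relation.Nullary using (¬_; Dec; yes; no; contradiction)
open import Relation.Nullary.Decidable using (⌊_⌋; _→-dec_)
open import Relation.Nullary.Reflects
  using (Reflects; ofʸ; ofⁿ; det; _×-reflects_; _⊎-reflects_; _→-reflects_; ¬-reflects)

open Equivalence using (to; from)

private variable
  A B : Set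
  a b : Bool
  m n : ℕ

-- Finite sums

∑ : List A → (A → ℕ) → ℕ
∑ xs f = sum (map f xs)

∑-cong : ∀ {f g : A → ℕ} xs → f ≗ g → ∑ xs f ≡ ∑ xs g
∑-cong xs f≗g = cong sum (map-cong f≗g xs)

∑-zero : ∀ (xs : List A) → ∑ xs (λ _ → 0) ≡ 0
∑-zero []       = refl
∑-zero (x ∷ xs) = ∑-zero xs

∑-+ : ∀ (xs : List A) (f g : A → ℕ) → ∑ xs (λ x → f x + g x) ≡ ∑ xs f + ∑ xs g
∑-+ []       f g = refl
∑-+ (x ∷ xs) f g = trans (cong (f x + g x +_) (∑-+ xs f g))
  (solve 4 (λ p q r s → p :+ q :+ (r :+ s) := p :+ r :+ (q :+ s)) refl (f x) (g x) (∑ xs f) (∑ xs g))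
  where open +-*-Solver

∑-swap : ∀ (xs : List A) (ys : List B) (F : A → B → ℕ) →
  ∑ xs (λ x → ∑ ys (F x)) ≡ ∑ ys (λ y → ∑ xs (λ x → F x y))
∑-swap []       ys F = sym (∑-zero ys)
∑-swap (x ∷ xs) ys F =
  trans (cong (∑ ys (F x) +_) (∑-swap xs ys F)) (sym (∑-+ ys (F x) _))

∑-*ˡ : ∀ (xs : List A) k (f : A → ℕ) → k ℕ.* ∑ xs f ≡ ∑ xs (λ x → k ℕ.* f x)
∑-*ˡ []       k f = ℕ.*-zeroʳ k
∑-*ˡ (x ∷ xs) k f = trans (ℕ.*-distribˡ-+ k (f x) _) (cong (k ℕ.* f x +_) (∑-*ˡ xs k f))

∑-concatMap : ∀ (xs : List A) (h : A → List B) (f : B → ℕ) →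
  ∑ (concatMap h xs) f ≡ ∑ xs (λ x → ∑ (h x) f)
∑-concatMap []       h f = refl
∑-concatMap (x ∷ xs) h f = begin
  sum (map f (h x ++ concatMap h xs)) ≡⟨ cong sum (map-++ f (h x) _) ⟩
  sum (map f (h x) ++ map f (concatMap h xs)) ≡⟨ sum-++ (map f (h x)) _ ⟩
  ∑ (h x) f + ∑ (concatMap h xs) f ≡⟨ cong (∑ (h x) f +_) (∑-concatMap xs h f) ⟩
  ∑ (h x) f + ∑ xs (λ x → ∑ (h x) f) ∎
  where open ≡-Reasoning

∑-map : ∀ (xs : List A) (h : A → B) (f : B → ℕ) → ∑ (map h xs) f ≡ ∑ xs (f ∘ h)
∑-map xs h f = cong sum (sym (map-∘ xs))

⟦_⟧ : Bool → ℕ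
⟦ b ⟧ = if b then 1 else 0

⟦∧⟧ : ∀ a b → ⟦ a ∧ b ⟧ ≡ ⟦ a ⟧ ℕ.* ⟦ b ⟧
⟦∧⟧ true  b = sym (ℕ.+-identityʳ ⟦ b ⟧)
⟦∧⟧ false b = refl

countB-none : ∀ (xs : List A) (p : A → Bool) → (∀ x → p x ≡ false) → countB p xs ≡ 0
countB-none xs p p≗false = trans (∑-cong xs (cong ⟦_⟧ ∘ p≗false)) (∑-zero xs)

if-countB : ∀ c (xs : List A) (p : A → Bool) →
  (if c then countB p xs else 0) ≡ countB (λ x → c ∧ p x) xs
if-countB true  xs p = refl
if-countB false xs p = sym (∑-zero xs)

countB-* : ∀ (xs : List A) (ys : List B) p q →
  countB p xs ℕ.* countB q ys ≡ ∑ xs (λ x → countB (λ y → p x ∧ q y) ys)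
countB-* []       ys p q = refl
countB-* (x ∷ xs) ys p q = begin
  (⟦ p x ⟧ + countB p xs) ℕ.* countB q ys
    ≡⟨ ℕ.*-distribʳ-+ (countB q ys) ⟦ p x ⟧ _ ⟩
  ⟦ p x ⟧ ℕ.* countB q ys + countB p xs ℕ.* countB q ys
    ≡⟨ cong₂ _+_ (trans (∑-*ˡ ys ⟦ p x ⟧ _) (∑-cong ys (λ y → sym (⟦∧⟧ (p x) (q y))))) (countB-* xs ys p q) ⟩
  countB (λ y → p x ∧ q y) ys + ∑ xs (λ x → countB (λ y → p x ∧ q y) ys) ∎
  where open ≡-Reasoning

-- Turns a guarded product of two pairings into a double sum of a single indicator, so that the sums
-- over `I`, `f` and `g` can be exchanged freely.
if-countB-* : ∀ c (xs : List A) (ys : List B) p q →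
  (if c then countB p xs ℕ.* countB q ys else 0)
    ≡ ∑ xs (λ x → countB (λ y → c ∧ (p x ∧ q y)) ys)
if-countB-* true  xs ys p q = countB-* xs ys p q
if-countB-* false xs ys p q = sym (trans (∑-cong xs (λ _ → ∑-zero ys)) (∑-zero xs))

-- Reflection of the Boolean predicates

holds : Reflects A b → A → b ≡ true
holds r x = det r (ofʸ x)

sound : Reflects A b → b ≡ true → A
sound (ofʸ x) refl = x

≡true-reflects : ∀ b → Reflects (b ≡ true) b
≡true-reflects true  = ofʸ refl
≡true-reflects false = ofⁿ λ ()

⇔⇒≡ : (a ≡ true → b ≡ true) → (b ≡ true → a ≡ true) → a ≡ b
⇔⇒≡ {true}  {b}     f g = sym (f refl)
⇔⇒≡ {false} {true}  f g = g refl
⇔⇒≡ {false} {false} f g = refl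

⌊⌋-reflects : (A? : Dec A) → Reflects A ⌊ A? ⌋
⌊⌋-reflects (yes x) = ofʸ x
⌊⌋-reflects (no ¬x) = ofⁿ ¬x

=ᶠ-reflects : (x y : Fin n) → Reflects (x ≡ y) (x =ᶠ y)
=ᶠ-reflects x y = ⌊⌋-reflects (x F.≟ y)

=ᵇ-reflects : ∀ a b → Reflects (a ≡ b) (a =ᵇ b)
=ᵇ-reflects a b = ⌊⌋-reflects (a 𝔹.≟ b)

-- Set equalities in the definitions are Boolean equalities of membership tests; this reads them as
-- equivalences between the propositions tested.
=ᵇ-⇔-reflects : Reflects A a → Reflects B b → Reflects (A ⇔ B) (a =ᵇ b)
=ᵇ-⇔-reflects (ofʸ x)  (ofʸ y)  = ofʸ (mk⇔ (λ _ → y) (λ _ → x))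
=ᵇ-⇔-reflects (ofʸ x)  (ofⁿ ¬y) = ofⁿ λ e → ¬y (to e x)
=ᵇ-⇔-reflects (ofⁿ ¬x) (ofʸ y)  = ofⁿ λ e → ¬x (from e y)
=ᵇ-⇔-reflects (ofⁿ ¬x) (ofⁿ ¬y) = ofʸ (mk⇔ (λ x → contradiction x ¬x) (λ y → contradiction y ¬y))

module _ {C : A → Set} {p : A → Bool} (r : ∀ x → Reflects (C x) (p x)) where

  all-reflects : ∀ xs → Reflects (All C xs) (all p xs)
  all-reflects [] = ofʸ []
  all-reflects (x ∷ xs) with p x | r x | all p xs | all-reflects xs
  ... | _ | ofʸ c  | _ | ofʸ cs  = ofʸ (c ∷ cs)
  ... | _ | ofʸ _  | _ | ofⁿ ¬cs = ofⁿ (¬cs ∘ All.tail)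
  ... | _ | ofⁿ ¬c | _ | _       = ofⁿ (¬c ∘ All.head)

  any-reflects : ∀ xs → Reflects (Any C xs) (any p xs)
  any-reflects [] = ofⁿ λ ()
  any-reflects (x ∷ xs) with p x | r x | any p xs | any-reflects xs
  ... | _ | ofʸ c  | _ | _       = ofʸ (here c)
  ... | _ | ofⁿ _  | _ | ofʸ cs  = ofʸ (there cs)
  ... | _ | ofⁿ ¬c | _ | ofⁿ ¬cs = ofⁿ λ { (here c) → ¬c c ; (there cs) → ¬cs cs }

Reflects-map : A ⇔ B → Reflects A b → Reflects B b
Reflects-map e (ofʸ x)  = ofʸ (to e x)
Reflects-map e (ofⁿ ¬x) = ofⁿ (¬x ∘ from e)

module _ {C : Fin n → Set} {p : Fin n → Bool} (r : ∀ x → Reflects (C x) (p x)) where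

  allF-reflects : Reflects (∀ x → C x) (allF n p)
  allF-reflects = Reflects-map
    (mk⇔ (λ cs x → All.lookup cs (∈-allFin x)) (λ c → All.universal c _)) (all-reflects r (allFin n))

  anyF-reflects : Reflects (∃ C) (anyF n p)
  anyF-reflects = Reflects-map
    (mk⇔ Any.satisfied (λ (x , c) → Any.map (λ { refl → c }) (∈-allFin x))) (any-reflects r (allFin n))

-- Enumerations

-- Evaluates the count of grafting points once the point `v` is known to be unique.
allFin-unique : ∀ n (v : Fin n) → countB (_=ᶠ v) (allFin n) ≡ 1
allFin-unique (suc n) v = begin
  ⟦ zero =ᶠ v ⟧ + countB (_=ᶠ v) (tabulate suc)
    ≡⟨ cong (λ xs → ⟦ zero =ᶠ v ⟧ + countB (_=ᶠ v) xs) (sym (map-tabulate id suc)) ⟩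
  ⟦ zero =ᶠ v ⟧ + countB (_=ᶠ v) (map suc (allFin n))
    ≡⟨ cong (⟦ zero =ᶠ v ⟧ +_) (∑-map (allFin n) suc _) ⟩
  ⟦ zero =ᶠ v ⟧ + countB (λ x → suc x =ᶠ v) (allFin n)
    ≡⟨ split v ⟩
  1 ∎
  where
  open ≡-Reasoning
  split : ∀ v → ⟦ zero =ᶠ v ⟧ + countB (λ x → suc x =ᶠ v) (allFin n) ≡ 1
  split zero    = cong suc (countB-none (allFin n) _ (λ x → det (=ᶠ-reflects (suc x) zero) (ofⁿ λ ())))
  split (suc v) = trans
    (∑-cong (allFin n) λ x → cong ⟦_⟧ (det (=ᶠ-reflects (suc x) (suc v))
      (Reflects-map (mk⇔ (cong suc) suc-injective) (=ᶠ-reflects x v))))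
    (allFin-unique n v)

_∷ᶠ_ : B → (Fin m → B) → Fin (suc m) → B
(b ∷ᶠ f) zero    = b
(b ∷ᶠ f) (suc i) = f i

_⧺_ : (Fin m → B) → (Fin n → B) → Fin (m + n) → B
_⧺_ {m} f g i = [ f , g ]′ (splitAt m i)

-- Functions listed by `funsOver` agree with rebuilt ones such as `b ∷ᶠ f` only pointwise, so a
-- summand has to be insensitive to pointwise equality.
Extensional : ((Fin m → B) → ℕ) → Set
Extensional F = ∀ {f g} → f ≗ g → F f ≡ F g

∑-funsOver-suc : ∀ (bs : List B) m (F : (Fin (suc m) → B) → ℕ) → Extensional F →
  ∑ (funsOver bs (suc m)) F ≡ ∑ (funsOver bs m) (λ f → ∑ bs (λ b → F (b ∷ᶠ f)))
∑-funsOver-suc bs m F ext = trans (∑-concatMap (funsOver bs m) _ F)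
  (∑-cong (funsOver bs m) λ f → trans (∑-map bs _ F)
    (∑-cong bs λ b → ext λ { zero → refl ; (suc i) → refl }))

-- A map on `m + n` points is a pair of maps on the two blocks; this is what splits a map out of a
-- grafted poset into `f` and `g`. In the induction on `m`, the sum over the first value is moved
-- outside the sum over `g`, where it extends `f`.
∑-funsOver-+ : ∀ (bs : List B) m n (F : (Fin (m + n) → B) → ℕ) → Extensional F →
  ∑ (funsOver bs (m + n)) F ≡ ∑ (funsOver bs m) (λ f → ∑ (funsOver bs n) (λ g → F (f ⧺ g)))
∑-funsOver-+ bs zero    n F ext = sym (ℕ.+-identityʳ _)
∑-funsOver-+ {B} bs (suc m) n F ext = begin
  ∑ (funsOver bs (suc m + n)) F
    ≡⟨ ∑-funsOver-suc bs (m + n) F ext ⟩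
  ∑ (funsOver bs (m + n)) (λ h → ∑ bs (λ b → F (b ∷ᶠ h)))
    ≡⟨ ∑-funsOver-+ bs m n _ (λ f≗g → ∑-cong bs λ b → ext λ { zero → refl ; (suc i) → f≗g i }) ⟩
  ∑ fs (λ f → ∑ gs (λ g → ∑ bs (λ b → F (b ∷ᶠ (f ⧺ g)))))
    ≡⟨ ∑-cong fs (λ f → ∑-swap gs bs _) ⟩
  ∑ fs (λ f → ∑ bs (λ b → ∑ gs (λ g → F (b ∷ᶠ (f ⧺ g)))))
    ≡⟨ ∑-cong fs (λ f → ∑-cong bs λ b → ∑-cong gs λ g → ext (∷ᶠ-⧺ b f g)) ⟩
  ∑ fs (λ f → ∑ bs (λ b → ∑ gs (λ g → F ((b ∷ᶠ f) ⧺ g))))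
    ≡⟨ sym (∑-funsOver-suc bs m _ (λ f≗f′ → ∑-cong gs λ g → ext (⧺-cong g f≗f′))) ⟩
  ∑ (funsOver bs (suc m)) (λ f → ∑ gs (λ g → F (f ⧺ g))) ∎
  where
  open ≡-Reasoning
  fs = funsOver bs m
  gs = funsOver bs n
  ∷ᶠ-⧺ : ∀ b (f : Fin m → B) (g : Fin n → B) → (b ∷ᶠ (f ⧺ g)) ≗ ((b ∷ᶠ f) ⧺ g)
  ∷ᶠ-⧺ b f g zero    = refl
  ∷ᶠ-⧺ b f g (suc i) = sym ([,]-map (splitAt m i))
  ⧺-cong : ∀ {m} (g : Fin n → B) {f f′ : Fin m → B} → f ≗ f′ → (f ⧺ g) ≗ (f′ ⧺ g)
  ⧺-cong {m} g f≗f′ i with splitAt m i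
  ... | inj₁ j = f≗f′ j
  ... | inj₂ j = refl

_≗ᵇ_ : (I J : Fin n → Bool) → Bool
I ≗ᵇ J = allF _ (λ x → I x =ᵇ J x)

≗ᵇ-reflects : (I J : Fin n → Bool) → Reflects (I ≗ J) (I ≗ᵇ J)
≗ᵇ-reflects I J = allF-reflects λ x → =ᵇ-reflects (I x) (J x)

-- Exactly one of the two Booleans matches `J zero`, and induction handles the remaining values.
-- Pointwise comparison is the right notion, since `J` itself need not be literally in the list.
subsets-unique : ∀ n (J : Fin n → Bool) → countB (_≗ᵇ J) (subsets n) ≡ 1
subsets-unique zero    J = refl
subsets-unique (suc n) J = begin
  countB (_≗ᵇ J) (subsets (suc n))
    ≡⟨ ∑-funsOver-suc bools n _ (λ {I} {I′} I≗I′ → cong ⟦_⟧ (det (≗ᵇ-reflects I J)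
         (Reflects-map (mk⇔ (λ e x → trans (I≗I′ x) (e x)) (λ e x → trans (sym (I≗I′ x)) (e x)))
           (≗ᵇ-reflects I′ J)))) ⟩
  ∑ (subsets n) (λ I → ∑ bools (λ b → ⟦ (b ∷ᶠ I) ≗ᵇ J ⟧))
    ≡⟨ ∑-cong (subsets n) (λ I → trans (∑-cong bools (λ b → cong ⟦_⟧ (∷ᶠ-≗ᵇ b I))) (one-head _ (J zero))) ⟩
  countB (_≗ᵇ (J ∘ suc)) (subsets n)
    ≡⟨ subsets-unique n (J ∘ suc) ⟩
  1 ∎
  where
  open ≡-Reasoning
  bools = true ∷ false ∷ []
  ∷ᶠ-≗ᵇ : ∀ b I → ((b ∷ᶠ I) ≗ᵇ J) ≡ (b =ᵇ J zero) ∧ (I ≗ᵇ (J ∘ suc))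
  ∷ᶠ-≗ᵇ b I = det (≗ᵇ-reflects (b ∷ᶠ I) J) (Reflects-map
    (mk⇔ (λ { (e , es) zero → e ; (e , es) (suc x) → es x }) (λ e → e zero , e ∘ suc))
    (=ᵇ-reflects b (J zero) ×-reflects ≗ᵇ-reflects I (J ∘ suc)))
  one-head : ∀ c b → ∑ bools (λ a → ⟦ (a =ᵇ b) ∧ c ⟧) ≡ ⟦ c ⟧
  one-head true  true  = refl
  one-head true  false = refl
  one-head false true  = refl
  one-head false false = refl

-- Connected components

comparable-reflects : ∀ P x y → Reflects (Comparable P x y) (le P x y ∨ le P y x)
comparable-reflects P x y = ≡true-reflects (le P x y) ⊎-reflects ≡true-reflects (le P y x)

-- One round of the search in `reach`. It unfolds to the same term as the local `stepR`, so that
-- `iterate P S x (suc k) T` computes to `iterate P S x k (grow P S T)`.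
grow : (P : RawPoset) (S T : Fin (size P) → Bool) → Fin (size P) → Bool
grow P S T y = T y ∨ (S y ∧ anyF (size P) (λ z → T z ∧ (le P z y ∨ le P y z)))

grow-reflects : ∀ P S T y →
  Reflects (T y ≡ true ⊎ (S y ≡ true × ∃ λ z → T z ≡ true × Comparable P z y)) (grow P S T y)
grow-reflects P S T y = ≡true-reflects (T y) ⊎-reflects (≡true-reflects (S y) ×-reflects
  anyF-reflects (λ z → ≡true-reflects (T z) ×-reflects comparable-reflects P z y))

-- Unlike `_≡_`, this does not take the type `Fin (size P) → Bool` as an argument, so `size P` can
-- be abstracted in a goal without disturbing that type.
record SameSubset (P : RawPoset) (I J : Fin (size P) → Bool) : Set where
  constructor same
  field equal : I ≡ J

-- The loop inside reach is a local function without a name of its own, so it is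
-- recovered by unification.  Its two arguments must be variables for that, hence the
-- abstractions; S and x are abstracted again to keep size P fixed in their types.
mutual
  iterate : (P : RawPoset) (S : Fin (size P) → Bool) (x : Fin (size P)) →
    ℕ → (Fin (size P) → Bool) → Fin (size P) → Bool
  iterate = _

  reach-iterate : ∀ P S x →
    SameSubset P (reach P S x) (iterate P S x (size P) (λ y → S y ∧ (y =ᶠ x)))
  reach-iterate P S x with (λ (y : Fin (size P)) → S y ∧ (y =ᶠ x))
  ... | T with S | x | T | size P
  ...   | S | x | T | n = same refl

module _ (P : RawPoset) (S : Fin (size P) → Bool) (x : Fin (size P)) where

  Closed : (Fin (size P) → Bool) → Set
  Closed T = ∀ y → grow P S T y ≡ true → T y ≡ true

  start : Fin (size P) → Bool
  start y = S y ∧ (y =ᶠ x)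

  start-reflects : ∀ y → Reflects (S y ≡ true × y ≡ x) (start y)
  start-reflects y = ≡true-reflects (S y) ×-reflects =ᶠ-reflects y x

  reach≗iterate : reach P S x ≗ iterate P S x (size P) start
  reach≗iterate y = cong (λ T → T y) (SameSubset.equal (reach-iterate P S x))

  grow-extends : ∀ T y → T y ≡ true → grow P S T y ≡ true
  grow-extends T y Ty = holds (grow-reflects P S T y) (inj₁ Ty)

  grow-closed : ∀ T → Closed T → Closed (grow P S T)
  grow-closed T closed y y∈ with sound (grow-reflects P S (grow P S T) y) y∈
  ... | inj₁ y∈T = y∈T
  ... | inj₂ (Sy , z , z∈ , z~y) = holds (grow-reflects P S T y) (inj₂ (Sy , z , closed z z∈ , z~y))

  iterate-extends : ∀ k T y → T y ≡ true → iterate P S x k T y ≡ true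
  iterate-extends zero    T y Ty = Ty
  iterate-extends (suc k) T y Ty = iterate-extends k (grow P S T) y (grow-extends T y Ty)

  iterate-preserves-closed : ∀ k T → Closed T → Closed (iterate P S x k T)
  iterate-preserves-closed zero    T closed = closed
  iterate-preserves-closed (suc k) T closed =
    iterate-preserves-closed k (grow P S T) (grow-closed T closed)

  -- The vector form gives access to cardinalities, which measure the progress of the search.
  subset : (Fin (size P) → Bool) → Subset (size P)
  subset = Vec.tabulate

  ∈⇒≡true : ∀ T {y} → y ∈ subset T → T y ≡ true
  ∈⇒≡true T {y} y∈ = trans (sym (lookup∘tabulate T y)) ([]=⇒lookup y∈)

  ≡true⇒∈ : ∀ T {y} → T y ≡ true → y ∈ subset T
  ≡true⇒∈ T {y} Ty = lookup⇒[]= y (subset T) (trans (lookup∘tabulate T y) Ty)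

  -- If `T` is not closed, decidability yields a point of `grow P S T` outside `T`, and the
  -- inclusion of `T` in `grow P S T` is then strict.
  closed? : ∀ T → Closed T ⊎ (∣ subset T ∣ ℕ.< ∣ subset (grow P S T) ∣)
  closed? T with all? (λ y → (grow P S T y 𝔹.≟ true) →-dec (T y 𝔹.≟ true))
  ... | yes closed = inj₁ closed
  ... | no ¬closed with ¬∀⟶∃¬ _ _ (λ y → (grow P S T y 𝔹.≟ true) →-dec (T y 𝔹.≟ true)) ¬closed
  ...   | y , ¬Cy = inj₂ (p⊂q⇒∣p∣<∣q∣
    ( (λ z∈ → ≡true⇒∈ (grow P S T) (grow-extends T _ (∈⇒≡true T z∈)))
    , y , ≡true⇒∈ (grow P S T) y∈grow , λ y∈T → ¬Cy (λ _ → ∈⇒≡true T y∈T)))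
    where
    y∈grow : grow P S T y ≡ true
    y∈grow with grow P S T y 𝔹.≟ true
    ... | yes y∈ = y∈
    ... | no y∉  = contradiction (λ y∈ → contradiction y∈ y∉) ¬Cy

  -- A subset which is not closed strictly grows, which can happen at most size P times.
  iterate-closed : ∀ k T → size P ℕ.≤ ∣ subset T ∣ + k → Closed (iterate P S x k T)
  iterate-closed k T bound with closed? T
  iterate-closed k T bound | inj₁ closed = iterate-preserves-closed k T closed
  -- With no rounds left the bound says that `T` already has `size P` elements, so it cannot grow.
  iterate-closed zero T bound | inj₂ grows = contradiction
    (ℕ.<-≤-trans grows (ℕ.≤-trans (∣p∣≤n (subset (grow P S T))) (subst (size P ℕ.≤_) (ℕ.+-identityʳ _) bound)))
    (ℕ.<-irrefl refl)
  iterate-closed (suc k) T bound | inj₂ grows = iterate-closed k (grow P S T)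
    (ℕ.≤-trans bound (ℕ.≤-trans (ℕ.≤-reflexive (ℕ.+-suc _ k)) (ℕ.+-monoˡ-≤ k grows)))

  -- Together with `reach-closed` and `reach-least`, this describes `reach P S x`, for `x` in `S`,
  -- as the least set containing `x` and closed under comparability within `S`. The later arguments
  -- about components use only these three facts.
  reach-start : S x ≡ true → reach P S x x ≡ true
  reach-start Sx = trans (reach≗iterate x)
    (iterate-extends (size P) start x (holds (start-reflects x) (Sx , refl)))

  reach-closed : ∀ y z → reach P S x y ≡ true → S z ≡ true → Comparable P y z → reach P S x z ≡ true
  reach-closed y z y∈ Sz y~z = trans (reach≗iterate z)
    -- The bound is immediate: `size P` rounds are enough whatever the size of `start`.
    (iterate-closed (size P) start (ℕ.m≤n+m _ _) z
      (holds (grow-reflects P S _ z) (inj₂ (Sz , y , trans (sym (reach≗iterate y)) y∈ , y~z))))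

  module _ (C : Fin (size P) → Set) (C-step : ∀ y z → C y → S z ≡ true → Comparable P y z → C z) where

    iterate-least : ∀ k T → (∀ y → T y ≡ true → C y) → ∀ y → iterate P S x k T y ≡ true → C y
    iterate-least zero    T T⊆C = T⊆C
    iterate-least (suc k) T T⊆C = iterate-least k (grow P S T) λ y y∈ → grow⊆C y (sound (grow-reflects P S T y) y∈)
      where
      grow⊆C : ∀ y → (T y ≡ true ⊎ (S y ≡ true × ∃ λ z → T z ≡ true × Comparable P z y)) → C y
      grow⊆C y (inj₁ Ty) = T⊆C y Ty
      grow⊆C y (inj₂ (Sy , z , Tz , z~y)) = C-step z y (T⊆C z Tz) Sy z~y

    reach-least : C x → ∀ y → reach P S x y ≡ true → C y
    reach-least Cx y y∈ = iterate-least (size P) start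
      (λ z z∈ → subst C (sym (proj₂ (sound (start-reflects z) z∈))) Cx)
      y (trans (sym (reach≗iterate y)) y∈)

-- Isomorphisms from a grafted poset

IsIsoOnto : (Q P : RawPoset) (S : Fin (size P) → Bool) → (Fin (size Q) → Fin (size P)) → Set
IsIsoOnto Q P S f =
    (∀ a b → f a ≡ f b → a ≡ b)
  × (∀ x → S x ≡ true ⇔ ∃ λ a → f a ≡ x)
  × (∀ a b → le Q a b ≡ le P (f a) (f b))

isIsoOnto-reflects : ∀ Q P S f → Reflects (IsIsoOnto Q P S f) (isIsoOnto Q P S f)
isIsoOnto-reflects Q P S f =
  allF-reflects (λ a → allF-reflects λ b → =ᶠ-reflects (f a) (f b) →-reflects =ᶠ-reflects a b)
  ×-reflects allF-reflects (λ x → =ᵇ-⇔-reflects (≡true-reflects (S x)) (anyF-reflects λ a → =ᶠ-reflects (f a) x))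
  ×-reflects allF-reflects (λ a → allF-reflects λ b → =ᵇ-reflects _ _)

IsIsoOnto-cong : ∀ Q P S {f g} → f ≗ g → IsIsoOnto Q P S f → IsIsoOnto Q P S g
IsIsoOnto-cong Q P S f≗g (injective , onto , order) =
    (λ a b e → injective a b (trans (f≗g a) (trans e (sym (f≗g b)))))
  , (λ x → mk⇔ (λ x∈ → let a , e = to (onto x) x∈ in a , trans (sym (f≗g a)) e)
                (λ (a , e) → from (onto x) (a , trans (f≗g a) e)))
  , (λ a b → trans (order a b) (cong₂ (le P) (f≗g a) (f≗g b)))

isIsoOnto-cong : ∀ Q P S {f g} → f ≗ g → isIsoOnto Q P S f ≡ isIsoOnto Q P S g
isIsoOnto-cong Q P S {f} {g} f≗g = det (isIsoOnto-reflects Q P S f)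
  (Reflects-map (mk⇔ (IsIsoOnto-cong Q P S (sym ∘ f≗g)) (IsIsoOnto-cong Q P S f≗g))
    (isIsoOnto-reflects Q P S g))

IsMin : (P : RawPoset) → Fin (size P) → Set
IsMin P x = ∀ y → le P y x ≡ true → y ≡ x

isMin-reflects : ∀ P x → Reflects (IsMin P x) (isMin P x)
isMin-reflects P x = allF-reflects λ y → ≡true-reflects (le P y x) →-reflects =ᶠ-reflects y x

above : (P : RawPoset) → Fin (size P) → Fin (size P) → Bool
above P u x = le P u x ∧ not (u =ᶠ x)

above-reflects : ∀ P u x → Reflects (le P u x ≡ true × u ≢ x) (above P u x)
above-reflects P u x = ≡true-reflects (le P u x) ×-reflects ¬-reflects (=ᶠ-reflects u x)

IsComponent : (P : RawPoset) (S I : Fin (size P) → Bool) → Set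
IsComponent P S I = (∀ x → I x ≡ true → S x ≡ true)
  × ∃ λ x → I x ≡ true × (∀ y → I y ≡ true ⇔ reach P S x y ≡ true)

-- The set written I₋ in the definition of the coproduct.
Below : (P : RawPoset) (I : Fin (size P) → Bool) → Fin (size P) → Set
Below P I x = ¬ I x ≡ true × ∃ λ y → I y ≡ true × le P x y ≡ true

Circ : (P : RawPoset) → (Fin (size P) → Bool) → Set
Circ P I = ∃ λ u → IsMin P u × (∀ x → Below P I x ⇔ x ≡ u) × IsComponent P (above P u) I

circ-reflects : ∀ P I → Reflects (Circ P I) (circ P I)
circ-reflects P I = anyF-reflects λ u → isMin-reflects P u
  ×-reflects allF-reflects (λ x → =ᵇ-⇔-reflects (¬-reflects (≡true-reflects (I x)) ×-reflects
      anyF-reflects (λ y → ≡true-reflects (I y) ×-reflects ≡true-reflects (le P x y)))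
    (=ᶠ-reflects x u))
  ×-reflects allF-reflects (λ x → ≡true-reflects (I x) →-reflects ≡true-reflects _)
  ×-reflects anyF-reflects (λ x → ≡true-reflects (I x) ×-reflects
      allF-reflects λ y → =ᵇ-⇔-reflects (≡true-reflects (I y)) (≡true-reflects _))

-- Case analysis on the block of an index, with goals stated for the injections, where the order of
-- `graft` and the map `f ⧺ g` can be simplified.
↑-elim : ∀ m n (C : Fin (m + n) → Set) → (∀ i → C (i ↑ˡ n)) → (∀ j → C (m ↑ʳ j)) → ∀ a → C a
↑-elim m n C left right a = subst C (join-splitAt m n a) (elim (splitAt m a))
  where
  elim : ∀ s → C (join m n s)
  elim (inj₁ i) = left i
  elim (inj₂ j) = right j

-- The condition that `f ⧺ g` is an isomorphism from `graft Q R v` onto `P`, resolved by blocks. The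
-- last four fields correspond to the four cases in the order of `graft`.
record GraftIso (P Q R : RawPoset) (v : Fin (size R))
    (f : Fin (size Q) → Fin (size P)) (g : Fin (size R) → Fin (size P)) : Set where
  field
    f-injective : ∀ i i′ → f i ≡ f i′ → i ≡ i′
    g-injective : ∀ j j′ → g j ≡ g j′ → j ≡ j′
    disjoint    : ∀ i j → f i ≢ g j
    cover       : ∀ x → (∃ λ i → f i ≡ x) ⊎ (∃ λ j → g j ≡ x)
    ff : ∀ i i′ → le Q i i′ ≡ le P (f i) (f i′)
    gg : ∀ j j′ → le R j j′ ≡ le P (g j) (g j′)
    gf : ∀ j i → le R j v ≡ le P (g j) (f i)
    fg : ∀ i j → false ≡ le P (f i) (g j)

module _ (P Q R : RawPoset) (v : Fin (size R))
    (f : Fin (size Q) → Fin (size P)) (g : Fin (size R) → Fin (size P)) where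

  private
    |Q| = size Q
    |R| = size R
    G = graft Q R v
    h = f ⧺ g

    hˡ : ∀ i → h (i ↑ˡ |R|) ≡ f i
    hˡ i rewrite splitAt-↑ˡ |Q| i |R| = refl

    hʳ : ∀ j → h (|Q| ↑ʳ j) ≡ g j
    hʳ j rewrite splitAt-↑ʳ |Q| |R| j = refl

    leˡˡ : ∀ i i′ → le G (i ↑ˡ |R|) (i′ ↑ˡ |R|) ≡ le Q i i′
    leˡˡ i i′ rewrite splitAt-↑ˡ |Q| i |R| | splitAt-↑ˡ |Q| i′ |R| = refl

    leʳʳ : ∀ j j′ → le G (|Q| ↑ʳ j) (|Q| ↑ʳ j′) ≡ le R j j′
    leʳʳ j j′ rewrite splitAt-↑ʳ |Q| |R| j | splitAt-↑ʳ |Q| |R| j′ = refl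

    leʳˡ : ∀ j i → le G (|Q| ↑ʳ j) (i ↑ˡ |R|) ≡ le R j v
    leʳˡ j i rewrite splitAt-↑ʳ |Q| |R| j | splitAt-↑ˡ |Q| i |R| = refl

    leˡʳ : ∀ i j → le G (i ↑ˡ |R|) (|Q| ↑ʳ j) ≡ false
    leˡʳ i j rewrite splitAt-↑ˡ |Q| i |R| | splitAt-↑ʳ |Q| |R| j = refl

  toGraftIso : IsIsoOnto G P (λ _ → true) h → GraftIso P Q R v f g
  toGraftIso (injective , onto , order) = record
    { f-injective = λ i i′ e → ↑ˡ-injective |R| i i′
        (injective _ _ (trans (hˡ i) (trans e (sym (hˡ i′)))))
    ; g-injective = λ j j′ e → ↑ʳ-injective |Q| j j′
        (injective _ _ (trans (hʳ j) (trans e (sym (hʳ j′)))))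
    ; disjoint = λ i j e → ↑ˡ≢↑ʳ i j (injective _ _ (trans (hˡ i) (trans e (sym (hʳ j)))))
    ; cover = λ x → let a , e = to (onto x) refl in
        ↑-elim |Q| |R| (λ a → h a ≡ x → _)
          (λ i e → inj₁ (i , trans (sym (hˡ i)) e)) (λ j e → inj₂ (j , trans (sym (hʳ j)) e)) a e
    ; ff = λ i i′ → trans (sym (leˡˡ i i′)) (trans (order _ _) (cong₂ (le P) (hˡ i) (hˡ i′)))
    ; gg = λ j j′ → trans (sym (leʳʳ j j′)) (trans (order _ _) (cong₂ (le P) (hʳ j) (hʳ j′)))
    ; gf = λ j i → trans (sym (leʳˡ j i)) (trans (order _ _) (cong₂ (le P) (hʳ j) (hˡ i)))
    ; fg = λ i j → trans (sym (leˡʳ i j)) (trans (order _ _) (cong₂ (le P) (hˡ i) (hʳ j)))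
    }
    where
    ↑ˡ≢↑ʳ : ∀ i j → i ↑ˡ |R| ≢ |Q| ↑ʳ j
    ↑ˡ≢↑ʳ i j e with trans (sym (splitAt-↑ˡ |Q| i |R|)) (trans (cong (splitAt |Q|) e) (splitAt-↑ʳ |Q| |R| j))
    ... | ()

  fromGraftIso : GraftIso P Q R v f g → IsIsoOnto G P (λ _ → true) h
  fromGraftIso iso =
      ↑-elim |Q| |R| _
        (λ i → ↑-elim |Q| |R| _
          (λ i′ e → cong (_↑ˡ |R|) (f-injective i i′ (trans (sym (hˡ i)) (trans e (hˡ i′)))))
          (λ j e → contradiction (trans (sym (hˡ i)) (trans e (hʳ j))) (disjoint i j)))
        (λ j → ↑-elim |Q| |R| _
          (λ i e → contradiction (sym (trans (sym (hʳ j)) (trans e (hˡ i)))) (disjoint i j))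
          (λ j′ e → cong (|Q| ↑ʳ_) (g-injective j j′ (trans (sym (hʳ j)) (trans e (hʳ j′))))))
    , (λ x → mk⇔ (λ _ → onto (cover x)) (λ _ → refl))
    , ↑-elim |Q| |R| _
        (λ i → ↑-elim |Q| |R| _
          (λ i′ → trans (leˡˡ i i′) (trans (ff i i′) (sym (cong₂ (le P) (hˡ i) (hˡ i′)))))
          (λ j → trans (leˡʳ i j) (trans (fg i j) (sym (cong₂ (le P) (hˡ i) (hʳ j))))))
        (λ j → ↑-elim |Q| |R| _
          (λ i → trans (leʳˡ j i) (trans (gf j i) (sym (cong₂ (le P) (hʳ j) (hˡ i)))))
          (λ j′ → trans (leʳʳ j j′) (trans (gg j j′) (sym (cong₂ (le P) (hʳ j) (hʳ j′))))))
    where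
    open GraftIso iso
    onto : ∀ {x} → (∃ λ i → f i ≡ x) ⊎ (∃ λ j → g j ≡ x) → ∃ λ a → h a ≡ x
    onto (inj₁ (i , e)) = i ↑ˡ |R| , trans (hˡ i) e
    onto (inj₂ (j , e)) = |Q| ↑ʳ j , trans (hʳ j) e

-- The correspondence between subsets and grafting points

module _ (P Q R : FinPoset) (Q-connected : Connected Q)
    (f : Fin (size (raw Q)) → Fin (size (raw P))) (g : Fin (size (raw R)) → Fin (size (raw P))) where

  private
    p = raw P
    q = raw Q
    r = raw R

    i₀ : Fin (size q)
    -- Connectedness includes non-emptiness. This point witnesses that `I` is non-empty, and it
    -- detects the grafting point through the elements below `f i₀`.
    i₀ = F.fromℕ< (proj₁ Q-connected)

  image : Fin (size p) → Bool
  image x = anyF (size q) (λ i → f i =ᶠ x)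

  image-reflects : ∀ x → Reflects (∃ λ i → f i ≡ x) (image x)
  image-reflects x = anyF-reflects λ i → =ᶠ-reflects (f i) x

  CutIso : (Fin (size p) → Bool) → Set
  CutIso I = Circ p I × IsIsoOnto q p I f × IsIsoOnto r p (not ∘ I) g

  cutIso-image : ∀ I → CutIso I → I ≗ image
  cutIso-image I (_ , (_ , onto , _) , _) x =
    ⇔⇒≡ (holds (image-reflects x) ∘ to (onto x)) (from (onto x) ∘ sound (image-reflects x))

  -- The element `u` of I₋ lies outside `I`, hence in the image of `g`, and `v` is its preimage.
  -- Minimality of `u` in `P` passes to `v` because `g` preserves and reflects the order.
  cut→graft : ∀ I → CutIso I → ∃ λ v → IsMin r v × GraftIso p q r v f g
  cut→graft I ((u , u-min , below , I⊆above , x₀ , x₀∈I , component)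
             , (f-injective , f-onto , f-order) , (g-injective , g-onto , g-order))
    = v , v-min , record
      { f-injective = f-injective
      ; g-injective = g-injective
      ; disjoint = λ i j e → g∉I j (trans (cong I (sym e)) (f∈I i))
      ; cover = cover
      ; ff = f-order
      ; gg = g-order
      -- Forwards, `g j` is below `g v`, which is below `f i`. Backwards, `g j` is outside `I` and
      -- below a point of it, so it is `u` and `j` is `v`.
      ; gf = λ j i → ⇔⇒≡ (λ j≤v → transitive P _ _ _ (trans (sym (g-order j v)) j≤v) (v≤f i))
               (λ gj≤fi → trans (cong (λ j → le r j v)
                 (g-injective j v (trans (to (below (g j)) (g∉I j , f i , f∈I i , gj≤fi)) (sym gv≡u))))
                 (reflexive R v))
      -- An element `g j` above `f i` would be strictly above `u` and comparable to a point of `I`,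
      -- so the component `I` would contain it.
      ; fg = λ i j → ⇔⇒≡ (λ ()) (λ fi≤gj → contradiction (closed (f i) (g j) (f∈I i)
               (g∈above i j fi≤gj) (inj₁ fi≤gj)) (g∉I j))
      }
    where
    f∈I : ∀ i → I (f i) ≡ true
    f∈I i = from (f-onto (f i)) (i , refl)

    g∉I : ∀ j → ¬ I (g j) ≡ true
    g∉I j gj∈I with trans (sym (from (g-onto (g j)) (j , refl))) (cong not gj∈I)
    ... | ()

    u∉I : ¬ I u ≡ true
    u∉I = proj₁ (from (below u) refl)

    v : Fin (size r)
    v = proj₁ (to (g-onto u) (cong not (¬-not u∉I)))

    gv≡u : g v ≡ u
    gv≡u = proj₂ (to (g-onto u) (cong not (¬-not u∉I)))

    v-min : IsMin r v
    v-min j j≤v = g-injective j v (trans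
      (u-min (g j) (trans (cong (le p (g j)) (sym gv≡u)) (trans (sym (g-order j v)) j≤v))) (sym gv≡u))

    u≤f : ∀ i → le p u (f i) ≡ true
    u≤f i = proj₁ (sound (above-reflects p u (f i)) (I⊆above (f i) (f∈I i)))

    v≤f : ∀ i → le p (g v) (f i) ≡ true
    v≤f i = trans (cong (λ x → le p x (f i)) gv≡u) (u≤f i)

    cover : ∀ x → (∃ λ i → f i ≡ x) ⊎ (∃ λ j → g j ≡ x)
    cover x with I x in eq
    ... | true  = inj₁ (to (f-onto x) eq)
    ... | false = inj₂ (to (g-onto x) (cong not eq))

    closed : ∀ y z → I y ≡ true → above p u z ≡ true → Comparable p y z → I z ≡ true
    closed y z y∈I z∈above y~z =
      from (component z) (reach-closed p (above p u) x₀ y z (to (component y) y∈I) z∈above y~z)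

    g∈above : ∀ i j → le p (f i) (g j) ≡ true → above p u (g j) ≡ true
    g∈above i j fi≤gj = holds (above-reflects p u (g j))
      ( transitive P _ _ _ (u≤f i) fi≤gj
      -- If `g j` were `u`, then `f i` would be below the minimal `u`, hence equal to it, although
      -- `u` is outside `I`.
      , λ u≡gj → u∉I (trans (cong I (sym (u-min (f i) (trans (cong (le p (f i)) u≡gj) fi≤gj)))) (f∈I i)))

  -- The element `u` is `g v`. The subset is any `I` pointwise equal to `image`, since enumerated
  -- subsets are identified only up to pointwise equality.
  graft→cut : ∀ v → IsMin r v → GraftIso p q r v f g → ∀ I → I ≗ image → CutIso I
  graft→cut v v-min iso I I≗image =
      ( g v
      , u-min
      , (λ x → mk⇔ below⇒ λ { refl → g∉I v , f i₀ , f∈I i₀ , v≤f i₀ })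
      , I⊆above , f i₀ , f∈I i₀ , λ y → mk⇔ I⊆reach (reach⊆I y))
    , (f-injective , I⇔ , ff)
    , (g-injective , (λ x → mk⇔ (∉I⇒ x) (λ { (j , refl) → cong not (¬-not (g∉I j)) })) , gg)
    where
    open GraftIso iso

    I⇔ : ∀ x → I x ≡ true ⇔ ∃ λ i → f i ≡ x
    I⇔ x = mk⇔ (λ x∈I → sound (image-reflects x) (trans (sym (I≗image x)) x∈I))
               (λ e → trans (I≗image x) (holds (image-reflects x) e))

    f∈I : ∀ i → I (f i) ≡ true
    f∈I i = from (I⇔ (f i)) (i , refl)

    g∉I : ∀ j → ¬ I (g j) ≡ true
    g∉I j gj∈I = let i , e = to (I⇔ (g j)) gj∈I in disjoint i j e

    v≤f : ∀ i → le p (g v) (f i) ≡ true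
    v≤f i = trans (sym (gf v i)) (reflexive R v)

    f≰g : ∀ i j → ¬ le p (f i) (g j) ≡ true
    f≰g i j e with trans (fg i j) e
    ... | ()

    u-min : IsMin p (g v)
    u-min y y≤ with cover y
    ... | inj₁ (i , refl) = contradiction y≤ (f≰g i v)
    ... | inj₂ (j , refl) = cong g (v-min j (trans (gg j v) y≤))

    g≤f⇒≡ : ∀ j i → le p (g j) (f i) ≡ true → g j ≡ g v
    g≤f⇒≡ j i gj≤fi = cong g (v-min j (trans (gf j i) gj≤fi))

    below⇒ : ∀ {x} → Below p I x → x ≡ g v
    below⇒ {x} (x∉I , y , y∈I , x≤y) with cover x | to (I⇔ y) y∈I
    ... | inj₁ (i , refl) | _        = contradiction (f∈I i) x∉I
    ... | inj₂ (j , refl) | i , refl = g≤f⇒≡ j i x≤y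

    f∈above : ∀ i → above p (g v) (f i) ≡ true
    f∈above i = holds (above-reflects p (g v) (f i)) (v≤f i , λ e → disjoint i v (sym e))

    I⊆above : ∀ x → I x ≡ true → above p (g v) x ≡ true
    I⊆above x x∈I with to (I⇔ x) x∈I
    ... | i , refl = f∈above i

    -- By `ff`, the map `f` carries a zigzag of `Q` to one in `P`, and all its points stay strictly
    -- above `g v`. This is how connectedness of `Q` makes `I` lie in a single component.
    f∈reach : ∀ {i j} → Zigzag q i j →
      reach p (above p (g v)) (f i₀) (f i) ≡ true → reach p (above p (g v)) (f i₀) (f j) ≡ true
    f∈reach here i∈ = i∈
    f∈reach (step {i} {j} i~j j~k) i∈ = f∈reach j~k
      (reach-closed p _ (f i₀) (f i) (f j) i∈ (f∈above j)
        (Sum.map (trans (sym (ff i j))) (trans (sym (ff j i))) i~j))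

    I⊆reach : ∀ {y} → I y ≡ true → reach p (above p (g v)) (f i₀) y ≡ true
    I⊆reach {y} y∈I with to (I⇔ y) y∈I
    ... | i , refl = f∈reach (proj₂ Q-connected i₀ i) (reach-start p _ (f i₀) (f∈above i₀))

    -- No comparability leads out of `I` strictly above `g v`: `f i` is never below `g j`, and `g j`
    -- below `f i` forces `g j` to be `g v` itself.
    reach⊆I : ∀ y → reach p (above p (g v)) (f i₀) y ≡ true → I y ≡ true
    reach⊆I = reach-least p _ (f i₀) (λ y → I y ≡ true) closed (f∈I i₀)
      where
      closed : ∀ y z → I y ≡ true → above p (g v) z ≡ true → Comparable p y z → I z ≡ true
      closed y z y∈I z∈above y~z with to (I⇔ y) y∈I | cover z | y~z
      ... | i , refl | inj₁ (i′ , refl) | _ = f∈I i′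
      ... | i , refl | inj₂ (j , refl) | inj₁ fi≤gj = contradiction fi≤gj (f≰g i j)
      ... | i , refl | inj₂ (j , refl) | inj₂ gj≤fi =
        contradiction (sym (g≤f⇒≡ j i gj≤fi)) (proj₂ (sound (above-reflects p (g v) (g j)) z∈above))

    ∉I⇒ : ∀ x → not (I x) ≡ true → ∃ λ j → g j ≡ x
    ∉I⇒ x x∉I with cover x
    ... | inj₂ e = e
    ... | inj₁ (i , refl) with trans (sym x∉I) (cong not (f∈I i))
    ...   | ()

  -- Under the second isomorphism, reflexivity at `w` puts `g w` below `f i₀`; the first one turns
  -- this into `w` below `v`, and `v` is minimal.
  graft-unique : ∀ v w → IsMin r v → GraftIso p q r v f g → GraftIso p q r w f g → w ≡ v
  graft-unique v w v-min iso iso′ = v-min w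
    (trans (GraftIso.gf iso w i₀) (trans (sym (GraftIso.gf iso′ w i₀)) (reflexive R w)))

  cutIso : (Fin (size p) → Bool) → Bool
  cutIso I = circ p I ∧ (isIsoOnto q p I f ∧ isIsoOnto r p (not ∘ I) g)

  cutIso-reflects : ∀ I → Reflects (CutIso I) (cutIso I)
  cutIso-reflects I = circ-reflects p I
    ×-reflects isIsoOnto-reflects q p I f ×-reflects isIsoOnto-reflects r p (not ∘ I) g

  graftIso : Fin (size r) → Bool
  graftIso v = isMin r v ∧ isIsoOnto (graft q r v) p (λ _ → true) (f ⧺ g)

  graftIso-reflects : ∀ v → Reflects (IsMin r v × GraftIso p q r v f g) (graftIso v)
  graftIso-reflects v = isMin-reflects r v ×-reflects
    Reflects-map (mk⇔ (toGraftIso p q r v f g) (fromGraftIso p q r v f g))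
      (isIsoOnto-reflects (graft q r v) p (λ _ → true) (f ⧺ g))

  -- For fixed `f` and `g` both counts are 0 or both are 1. Without a grafting point, `cut→graft`
  -- excludes every subset. With a grafting point `v`, the subsets counted are exactly those
  -- pointwise equal to `image`, and the points counted are exactly `v`.
  countB-cut≡graft : countB cutIso (subsets (size p)) ≡ countB graftIso (allFin (size r))
  countB-cut≡graft with any? (λ v → graftIso v 𝔹.≟ true)
  ... | no ∄v = trans
    (countB-none (subsets (size p)) cutIso (λ I → ¬-not λ cut →
      let v , graft = cut→graft I (sound (cutIso-reflects I) cut)
      in ∄v (v , holds (graftIso-reflects v) graft)))
    (sym (countB-none (allFin (size r)) graftIso (λ v → ¬-not λ graft → ∄v (v , graft))))
  ... | yes (v , v∈) with sound (graftIso-reflects v) v∈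
  ...   | v-min , iso = begin
    countB cutIso (subsets (size p))
      ≡⟨ ∑-cong (subsets (size p)) (λ I → cong ⟦_⟧ (det (cutIso-reflects I)
           (Reflects-map (mk⇔ (graft→cut v v-min iso I) (cutIso-image I)) (≗ᵇ-reflects I image)))) ⟩
    countB (_≗ᵇ image) (subsets (size p))
      ≡⟨ subsets-unique (size p) image ⟩
    1
      ≡⟨ sym (allFin-unique (size r) v) ⟩
    countB (_=ᶠ v) (allFin (size r))
      ≡⟨ ∑-cong (allFin (size r)) (λ w → cong ⟦_⟧ (det (=ᶠ-reflects w v)
           (Reflects-map (mk⇔ (graft-unique v w v-min iso ∘ proj₂) (λ { refl → v-min , iso }))
             (graftIso-reflects w)))) ⟩
    countB graftIso (allFin (size r)) ∎
    where open ≡-Reasoning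

-- Exchange of summations

pairSum-triangle : ∀ P Q R → pairSum P (triangle Q R) ≡
  ∑ (allFin (size R)) (λ v →
    countB (λ h → isMin R v ∧ isIsoOnto (graft Q R v) P (λ _ → true) h)
      (funsOver (allFin (size P)) (size Q + size R)))
pairSum-triangle P Q R = trans (∑-concatMap (allFin (size R)) _ (pair P))
  -- Non-minimal `v` give no term in `triangle`; here they stay in the sum with a vanishing
  -- indicator, so that the range is independent of `f` and `g`.
  (∑-cong (allFin (size R)) λ v → trans (single (isMin R v) (graft Q R v)) (if-countB (isMin R v) hs _))
  where
  hs = funsOver (allFin (size P)) (size Q + size R)
  single : ∀ b G → ∑ (if b then G ∷ [] else []) (pair P) ≡ (if b then pair P G else 0)
  single true  G = ℕ.+-identityʳ _
  single false G = refl

theorem3p18 : (P Q R : FinPoset) → Connected P → Connected Q → Connected R →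
    deltaPair (raw P) (raw Q) (raw R)
    ≡ recip (|min| (raw P)) * ℕ→ℚ (pairSum (raw P) (triangle (raw Q) (raw R)))
-- Both sides carry the same factor `recip (|min| p)`, which leaves an identity of natural numbers.
theorem3p18 P Q R _ Q-connected _ = cong (λ k → recip (|min| p) * ℕ→ℚ k) (begin
  ∑ Is (λ I → if circ p I then pairSub p I q ℕ.* pairSub p (not ∘ I) r else 0)
    ≡⟨ ∑-cong Is (λ I → if-countB-* (circ p I) fs gs _ _) ⟩
  ∑ Is (λ I → ∑ fs (λ f → ∑ gs (λ g → ⟦ cutIso P Q R Q-connected f g I ⟧)))
    ≡⟨ ∑-swap Is fs _ ⟩
  ∑ fs (λ f → ∑ Is (λ I → ∑ gs (λ g → ⟦ cutIso P Q R Q-connected f g I ⟧)))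
    ≡⟨ ∑-cong fs (λ f → ∑-swap Is gs _) ⟩
  ∑ fs (λ f → ∑ gs (λ g → countB (cutIso P Q R Q-connected f g) Is))
    ≡⟨ ∑-cong fs (λ f → ∑-cong gs λ g → countB-cut≡graft P Q R Q-connected f g) ⟩
  ∑ fs (λ f → ∑ gs (λ g → countB (graftIso P Q R Q-connected f g) vs))
    ≡⟨ sym (∑-cong fs (λ f → ∑-swap vs gs _)) ⟩
  ∑ fs (λ f → ∑ vs (λ v → ∑ gs (λ g → ⟦ graftIso P Q R Q-connected f g v ⟧)))
    ≡⟨ sym (∑-swap vs fs _) ⟩
  ∑ vs (λ v → ∑ fs (λ f → ∑ gs (λ g → ⟦ graftIso P Q R Q-connected f g v ⟧)))
    -- Read from right to left, a map out of the grafted poset is cut into its restrictions to the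
    -- two blocks.
    ≡⟨ sym (∑-cong vs λ v → ∑-funsOver-+ (allFin (size p)) (size q) (size r) _ λ f≗g →
         cong (λ b → ⟦ isMin r v ∧ b ⟧) (isIsoOnto-cong (graft q r v) p _ f≗g)) ⟩
  ∑ vs (λ v → countB (λ h → isMin r v ∧ isIsoOnto (graft q r v) p (λ _ → true) h)
    (funsOver (allFin (size p)) (size q + size r)))
    ≡⟨ sym (pairSum-triangle p q r) ⟩
  pairSum p (triangle q r) ∎)
  where
  open ≡-Reasoning
  p = raw P
  q = raw Q
  r = raw R
  Is = subsets (size p)
  fs = funsOver (allFin (size p)) (size q)
  gs = funsOver (allFin (size p)) (size r)
  vs = allFin (size r)
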